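{- Let $\lambda$ be an infinite cardinal and let $\mathcal{K}$ be a structure-class such that $\mathcal{K}_\lambda$ is a subcanonical AP class. Then the following are equivalent: (1) $\mathcal{K}_\lambda$ has the maximal extension property, and every maximal structure in $\mathcal{K}_\lambda$ is rigid. (2) The sheaf topos $\mathrm{Sh}(\mathcal{K}_\lambda^{\mathrm{op}},J_{\mathrm{at}})$ satisfies the external axiom of choice.
   Context: A structure-class is a category $\mathcal{K}$ with a faithful functor $|-|:\mathcal{K}\to\mathbf{Set}$ such that: (i) for each morphism $f$, $|f|$ is injective; (ii) if $|f|$ is a bijection then $f$ is an isomorphism; (iii) (transportability) for each object $A$ and bijection $\sigma:|A|\to X$ there is an isomorphism $\bar\sigma:A\to A^\sigma$ in $\mathcal{K}$ with $|A^\sigma|=X$, $|\bar\sigma|=\sigma$; (iv) for each set $X$ the objects $A$ with $|A|=X$ form a set. Objects are called structures and morphisms embeddings. $\mathcal{K}_\lambda$ is the full subcategory of structures whose carrier has cardinality at most $\lambda$; it is essentially small, and (pre)sheaves on $\mathcal{K}_\lambda^{\mathrm{op}}$ are taken over an equivalent small category. Amalgamation property (AP) of $\mathcal{K}_\lambda$: for all $f:A\to B$, $g:A\to C$ in $\mathcal{K}_\lambda$ there are $h:B\to D$, $k:C\to D$ in $\mathcal{K}_\lambda$ with $hf=kg$. Coherence axiom: for all morphisms $g:A\to C$, $h:B\to C$ and every function $f:|A|\to|B|$ with $|g|=|h|\circ f$ there is a morphism $\bar f:A\to B$ with $|\bar f|=f$. The atomic topology $J_{\mathrm{at}}$ on $\mathcal{K}_\lambda^{\mathrm{op}}$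 is the Grothendieck topology whose covering families are exactly the nonempty families. It is subcanonical if every representable presheaf is a sheaf. $\mathcal{K}_\lambda$ is a subcanonical AP class if it satisfies the coherence axiom and the AP, and $J_{\mathrm{at}}$ on $\mathcal{K}_\lambda^{\mathrm{op}}$ is subcanonical. A structure $M\in\mathcal{K}_\lambda$ is maximal if every embedding $M\to B$ in $\mathcal{K}_\lambda$ is an isomorphism. $\mathcal{K}_\lambda$ has the maximal extension property if every $A\in\mathcal{K}_\lambda$ admits an embedding in $\mathcal{K}_\lambda$ into a maximal structure of $\mathcal{K}_\lambda$. A structure $M$ is rigid if its only automorphism in $\mathcal{K}$ is the identity. A topos satisfies the external axiom of choice if every epimorphism $f:X\to I$ splits, i.e. there is $s:I\to X$ with $fs=1_I$. The metatheory is assumed to satisfy the axiom of choice. -}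

module Defs where

open import Axiom.ExcludedMiddle using (ExcludedMiddle)
open import Axiom.Extensionality.Propositional using (Extensionality)
open import Data.Bool.Base using (Bool; true; false)
open import Data.Fin.Base using (Fin)
open import Data.Product using (Σ; Σ-syntax; ∃; ∃-syntax; ∃!; _×_; _,_; proj₁; proj₂)
open import Data.Unit.Polymorphic.Base using (⊤; tt)
open import Function.Bundles using (_↔_; _↣_; _⇔_; mk⇔; mk↣; Inverse; Injection)
open import Function.Definitions using (Injective; Bijective)
open import Level using (Level; suc; _⊔_; Lift; lift; lower)
open import Relation.Binary.PropositionalEquality
  using (_≡_; _≗_; refl; sym; trans; cong; subst; module ≡-Reasoning)
open import Relation.Binary.PropositionalEquality.WithK using (≡-irrelevant)
open import Relation.Nullary using (¬_; Dec; yes; does)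
open import Relation.Nullary.Decidable using (recompute; map′; decidable-stable; dec-true)

private
  variable
    o h o′ h′ ℓ : Level

------------------------------------------------------------------------
-- Metatheory

-- The sets are the types in `Set ℓ` (with axiom K), the classes those in
-- `Set (suc ℓ)`.  The library's `ExcludedMiddle` decides every type, not only
-- every proposition, so it contains the axiom of choice; see `choice`.

record ClassicalMetatheory (ℓ : Level) : Set (suc (suc ℓ)) where
  field
    funext         : Extensionality (suc ℓ) (suc ℓ)
    excludedMiddle : ExcludedMiddle (suc ℓ)

  decide : (P : Set ℓ) → Dec P
  decide P = map′ lower lift (excludedMiddle {P = Lift (suc ℓ) P})

  choice : {A B : Set ℓ} (R : A → B → Set ℓ) →
           (∀ a → ¬ (∀ b → ¬ R a b)) → ∃[ f ] (∀ a → R a (f a))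
  choice {A} {B} R total = (λ a → proj₁ (pick a)) , (λ a → proj₂ (pick a))
    where
    pick : ∀ a → Σ[ b ∈ B ] R a b
    pick a = decidable-stable (decide _) λ none → total a λ b r → none (b , r)

-- Cardinals are represented by sets.

InfiniteCardinal : Set ℓ → Set ℓ
InfiniteCardinal Λ = ∀ n → ¬ (Λ ↔ Fin n)

------------------------------------------------------------------------
-- Categories

record Category (o h : Level) : Set (suc (o ⊔ h)) where
  infix  4 _⇒_ _≅_
  infixr 9 _∘_
  field
    Obj       : Set o
    _⇒_       : Obj → Obj → Set h
    id        : ∀ {A} → A ⇒ A
    _∘_       : ∀ {A B C} → B ⇒ C → A ⇒ B → A ⇒ C
    identityˡ : ∀ {A B} {f : A ⇒ B} → id ∘ f ≡ f
    identityʳ : ∀ {A B} {f : A ⇒ B} → f ∘ id ≡ f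
    assoc     : ∀ {A B C D} {f : A ⇒ B} {g : B ⇒ C} {k : C ⇒ D} →
                (k ∘ g) ∘ f ≡ k ∘ (g ∘ f)

  IsIso : ∀ {A B} → A ⇒ B → Set h
  IsIso {A} {B} f = Σ[ g ∈ B ⇒ A ] (g ∘ f ≡ id × f ∘ g ≡ id)

  _≅_ : Obj → Obj → Set h
  A ≅ B = Σ (A ⇒ B) IsIso

  IsEpi : ∀ {A B} → A ⇒ B → Set (o ⊔ h)
  IsEpi {A} {B} f = ∀ {C} (u v : B ⇒ C) → u ∘ f ≡ v ∘ f → u ≡ v

  IsSplitEpi : ∀ {A B} → A ⇒ B → Set h
  IsSplitEpi {A} {B} f = Σ[ s ∈ B ⇒ A ] f ∘ s ≡ id

  IsMaximal : Obj → Set (o ⊔ h)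
  IsMaximal M = ∀ B (f : M ⇒ B) → IsIso f

  IsRigid : Obj → Set h
  IsRigid M = ∀ (f : M ⇒ M) → IsIso f → f ≡ id

  AmalgamationProperty : Set (o ⊔ h)
  AmalgamationProperty = ∀ A B C (f : A ⇒ B) (g : A ⇒ C) →
    Σ[ D ∈ Obj ] Σ[ k ∈ B ⇒ D ] Σ[ l ∈ C ⇒ D ] k ∘ f ≡ l ∘ g

  MaximalExtensionProperty : Set (o ⊔ h)
  MaximalExtensionProperty = ∀ A → Σ[ M ∈ Obj ] (IsMaximal M × (A ⇒ M))

  ExternalChoice : Set (o ⊔ h)
  ExternalChoice = ∀ {X I} (f : X ⇒ I) → IsEpi f → IsSplitEpi f

op : Category o h → Category o h
op 𝒞 = record
  { Obj       = Obj
  ; _⇒_       = λ A B → B ⇒ A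
  ; id        = id
  ; _∘_       = λ f g → g ∘ f
  ; identityˡ = identityʳ
  ; identityʳ = identityˡ
  ; assoc     = sym assoc
  }
  where open Category 𝒞

record Functor (𝒞 : Category o h) (𝒟 : Category o′ h′) : Set (o ⊔ h ⊔ o′ ⊔ h′) where
  private
    module C = Category 𝒞
    module D = Category 𝒟
  field
    F₀   : C.Obj → D.Obj
    F₁   : ∀ {A B} → A C.⇒ B → F₀ A D.⇒ F₀ B
    F-id : ∀ {A} → F₁ (C.id {A}) ≡ D.id
    F-∘  : ∀ {A B C} (g : B C.⇒ C) (f : A C.⇒ B) → F₁ (g C.∘ f) ≡ F₁ g D.∘ F₁ f

record IsEquivalence {𝒞 : Category o h} {𝒟 : Category o′ h′} (F : Functor 𝒞 𝒟) :
                     Set (o ⊔ h ⊔ o′ ⊔ h′) where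
  private
    module C = Category 𝒞
    module D = Category 𝒟
  open Functor F
  field
    full     : ∀ A B (g : F₀ A D.⇒ F₀ B) → Σ[ f ∈ A C.⇒ B ] F₁ f ≡ g
    faithful : ∀ {A B} (f g : A C.⇒ B) → F₁ f ≡ F₁ g → f ≡ g
    essSurj  : ∀ D → Σ[ C ∈ C.Obj ] F₀ C D.≅ D

record SmallEquivalent {ℓ} (𝒟 : Category o ℓ) : Set (o ⊔ suc ℓ) where
  field
    category      : Category ℓ ℓ
    functor       : Functor category 𝒟
    isEquivalence : IsEquivalence functor

-- Functors to the category of sets; equality of functions is pointwise.

record SetFunctor (𝒞 : Category o h) (ℓ : Level) : Set (o ⊔ h ⊔ suc ℓ) where
  open Category 𝒞
  field
    F₀   : Obj → Set ℓ
    F₁   : ∀ {A B} → A ⇒ B → F₀ A → F₀ B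
    F-id : ∀ {A} → F₁ (id {A}) ≗ (λ x → x)
    F-∘  : ∀ {A B C} (g : B ⇒ C) (f : A ⇒ B) → F₁ (g ∘ f) ≗ (λ x → F₁ g (F₁ f x))

------------------------------------------------------------------------
-- Sheaves on a small site

module _ {ℓ} (𝒞 : Category ℓ ℓ) where
  open Category 𝒞

  Presheaf : Set (suc ℓ)
  Presheaf = SetFunctor (op 𝒞) ℓ

  representable : Obj → Presheaf
  representable c = record
    { F₀   = λ d → d ⇒ c
    ; F₁   = λ g f → f ∘ g
    ; F-id = λ _ → identityʳ
    ; F-∘  = λ _ _ _ → sym assoc
    }

  record Sieve (c : Obj) : Set (suc ℓ) where
    field
      arrows : ∀ {d} → d ⇒ c → Set ℓ
      closed : ∀ {d e} {f : d ⇒ c} (g : e ⇒ d) → arrows f → arrows (f ∘ g)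
  open Sieve public

  maximalSieve : ∀ c → Sieve c
  maximalSieve c .arrows _   = ⊤
  maximalSieve c .closed _ _ = tt

  pullback : ∀ {c d} → d ⇒ c → Sieve c → Sieve d
  pullback g S .arrows f   = arrows S (g ∘ f)
  pullback g S .closed k p = subst (arrows S) assoc (closed S k p)

  generated : ∀ {c} {I : Set ℓ} (dom : I → Obj) → (∀ i → dom i ⇒ c) → Sieve c
  generated {c} {I} dom f .arrows {d} g = Σ[ i ∈ I ] Σ[ k ∈ d ⇒ dom i ] f i ∘ k ≡ g
  generated dom f .closed k (i , l , eq) =
    i , l ∘ k , trans (sym assoc) (cong (_∘ k) eq)

  record GrothendieckTopology : Set (suc ℓ) where
    field
      Covers       : ∀ {c} → Sieve c → Set ℓ
      maximal      : ∀ c → Covers (maximalSieve c)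
      stable       : ∀ {c d} (g : d ⇒ c) (S : Sieve c) → Covers S → Covers (pullback g S)
      transitive   : ∀ {c} (S R : Sieve c) → Covers S →
                     (∀ {d} (f : d ⇒ c) → arrows S f → Covers (pullback f R)) →
                     Covers R

    CoveringFamily : ∀ {c} {I : Set ℓ} (dom : I → Obj) → (∀ i → dom i ⇒ c) → Set ℓ
    CoveringFamily dom f = Covers (generated dom f)

  Nonempty : ∀ {c} → Sieve c → Set ℓ
  Nonempty {c} S = Σ[ d ∈ Obj ] Σ[ f ∈ d ⇒ c ] arrows S f

  atomicTopology : Category.AmalgamationProperty (op 𝒞) → GrothendieckTopology
  atomicTopology ap = record
    { Covers     = Nonempty
    ; maximal    = λ c → c , id , tt
    ; stable     = stable
    ; transitive = λ S R (d , f , p) loc → let (e , g , q) = loc f p in e , f ∘ g , q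
    }
    where
    stable : ∀ {c d} (g : d ⇒ c) (S : Sieve c) → Nonempty S → Nonempty (pullback g S)
    stable {c} {d} g S (e , f , p) =
      let (a , k , l , eq) = ap c e d f g
      in a , l , subst (arrows S) eq (closed S k p)

  -- The families covering for the atomic topology are the nonempty ones.
  atomic-coveringFamily :
    (ap : Category.AmalgamationProperty (op 𝒞)) →
    ∀ {c} {I : Set ℓ} (dom : I → Obj) (f : ∀ i → dom i ⇒ c) →
    GrothendieckTopology.CoveringFamily (atomicTopology ap) dom f ⇔ I
  atomic-coveringFamily ap dom f =
    mk⇔ (λ (_ , _ , i , _) → i) (λ i → dom i , f i , i , id , identityʳ)

  -- Membership in a sieve need not be a proposition, but `matching` for g = id
  -- forces `section` to be independent of the membership proof.
  record MatchingFamily (F : Presheaf) {c} (S : Sieve c) : Set ℓ where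
    open SetFunctor F
    field
      section  : ∀ {d} (f : d ⇒ c) → arrows S f → F₀ d
      matching : ∀ {d e} (f : d ⇒ c) (p : arrows S f) (g : e ⇒ d) (q : arrows S (f ∘ g)) →
                 F₁ g (section f p) ≡ section (f ∘ g) q

  IsAmalgamation : ∀ (F : Presheaf) {c} {S : Sieve c} →
                   MatchingFamily F S → SetFunctor.F₀ F c → Set ℓ
  IsAmalgamation F {c} {S} x y = ∀ {d} (f : d ⇒ c) (p : arrows S f) → F₁ f y ≡ section f p
    where
    open SetFunctor F
    open MatchingFamily x

  module _ (J : GrothendieckTopology) where
    open GrothendieckTopology J

    IsSheaf : Presheaf → Set (suc ℓ)
    IsSheaf F = ∀ {c} (S : Sieve c) → Covers S →
                (x : MatchingFamily F S) → ∃! _≡_ (IsAmalgamation F x)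

    Subcanonical : Set (suc ℓ)
    Subcanonical = ∀ c → IsSheaf (representable c)

    record Sheaf : Set (suc ℓ) where
      field
        presheaf : Presheaf
        isSheaf  : IsSheaf presheaf
      open SetFunctor presheaf public

    -- Naturality is an irrelevant field so that the category laws hold
    -- definitionally; it can be recovered by matching and `recompute`.
    record SheafMorphism (F G : Sheaf) : Set ℓ where
      constructor mkMorphism
      private
        module F = Sheaf F
        module G = Sheaf G
      field
        η        : ∀ c → F.F₀ c → G.F₀ c
        .natural : ∀ {c d} (f : d ⇒ c) (x : F.F₀ c) → η d (F.F₁ f x) ≡ G.F₁ f (η c x)

    Sh : Category (suc ℓ) ℓ
    Sh = record
      { Obj       = Sheaf
      ; _⇒_       = SheafMorphism
      ; id        = record { η = λ _ x → x ; natural = λ _ _ → refl }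
      ; _∘_       = λ (mkMorphism β β-nat) (mkMorphism α α-nat) → mkMorphism
        (λ c x → β c (α c x))
        (λ f x → trans (cong (β _) (α-nat f x)) (β-nat f (α _ x)))
      ; identityˡ = refl
      ; identityʳ = refl
      ; assoc     = refl
      }

------------------------------------------------------------------------
-- Structure-classes

record StructureClass (ℓ : Level) : Set (suc (suc ℓ)) where
  field
    category : Category (suc ℓ) ℓ
    carrier  : SetFunctor category ℓ
  open Category category public
  open SetFunctor carrier public using ()
    renaming (F₀ to ∣_∣; F₁ to ∣_∣₁; F-id to ∣id∣; F-∘ to ∣∘∣)
  field
    faithful   : ∀ {A B} {f g : A ⇒ B} → ∣ f ∣₁ ≗ ∣ g ∣₁ → f ≡ g
    injective  : ∀ {A B} (f : A ⇒ B) → Injective _≡_ _≡_ ∣ f ∣₁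
    bijective⇒iso : ∀ {A B} (f : A ⇒ B) → Bijective _≡_ _≡_ ∣ f ∣₁ → IsIso f
    transport  : ∀ A {X : Set ℓ} (σ : ∣ A ∣ → X) → Bijective _≡_ _≡_ σ →
                 Σ[ Aσ ∈ Obj ] Σ[ σ̄ ∈ A ⇒ Aσ ]
                 (IsIso σ̄ × Σ[ eq ∈ ∣ Aσ ∣ ≡ X ] (subst (λ Y → ∣ A ∣ → Y) eq ∣ σ̄ ∣₁ ≗ σ))
    fibreSmall : ∀ (X : Set ℓ) → Σ[ S ∈ Set ℓ ] (S ↔ (Σ[ A ∈ Obj ] ∣ A ∣ ≡ X))

module _ {ℓ} (𝒦 : StructureClass ℓ) (Λ : Set ℓ) where
  open StructureClass 𝒦

  -- The bound is irrelevant, so it is a property of the structure rather than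
  -- a choice of injection.
  record BoundedStructure : Set (suc ℓ) where
    constructor mkBounded
    field
      structure : Obj
      .bounded  : ∣ structure ∣ ↣ Λ
  open BoundedStructure public

  Bounded : Category (suc ℓ) ℓ
  Bounded = record
    { Obj       = BoundedStructure
    ; _⇒_       = λ A B → structure A ⇒ structure B
    ; id        = id
    ; _∘_       = _∘_
    ; identityˡ = identityˡ
    ; identityʳ = identityʳ
    ; assoc     = assoc
    }

  Coherence : Set (suc ℓ)
  Coherence = ∀ (A B C : BoundedStructure)
    (g : structure A ⇒ structure C) (k : structure B ⇒ structure C)
    (f : ∣ structure A ∣ → ∣ structure B ∣) →
    ∣ g ∣₁ ≗ (λ x → ∣ k ∣₁ (f x)) →
    Σ[ f̄ ∈ structure A ⇒ structure B ] (∣ f̄ ∣₁ ≗ f)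

  -- A small category to serve as the site 𝒦_λ^op.
  SmallSite : Set (suc ℓ)
  SmallSite = SmallEquivalent (op Bounded)

  site-amalgamation : (S : SmallSite) → Category.AmalgamationProperty Bounded →
    Category.AmalgamationProperty (op (SmallEquivalent.category S))
  site-amalgamation S ap a b c f g = d , u , v , faithful′ _ _ square
    where
    open SmallEquivalent S
    open Functor functor
    open IsEquivalence isEquivalence renaming (faithful to faithful′)
    module C = Category (SmallEquivalent.category S)
    amalgam = ap (F₀ a) (F₀ b) (F₀ c) (F₁ f) (F₁ g)
    D = proj₁ amalgam
    k = proj₁ (proj₂ amalgam)
    l = proj₁ (proj₂ (proj₂ amalgam))
    k∘f≡l∘g = proj₂ (proj₂ (proj₂ amalgam))
    d = proj₁ (essSurj D)
    i : structure D ⇒ structure (F₀ d)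
    i = proj₁ (proj₂ (essSurj D))
    u = proj₁ (full d b (i ∘ k))
    v = proj₁ (full d c (i ∘ l))
    square : F₁ (f C.∘ u) ≡ F₁ (g C.∘ v)
    square = begin
      F₁ (f C.∘ u)       ≡⟨ F-∘ f u ⟩
      F₁ u ∘ F₁ f        ≡⟨ cong (_∘ F₁ f) (proj₂ (full d b (i ∘ k))) ⟩
      (i ∘ k) ∘ F₁ f     ≡⟨ assoc ⟩
      i ∘ (k ∘ F₁ f)     ≡⟨ cong (i ∘_) k∘f≡l∘g ⟩
      i ∘ (l ∘ F₁ g)     ≡⟨ assoc ⟨
      (i ∘ l) ∘ F₁ g     ≡⟨ cong (_∘ F₁ g) (proj₂ (full d c (i ∘ l))) ⟨
      F₁ v ∘ F₁ g        ≡⟨ F-∘ g v ⟨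
      F₁ (g C.∘ v)       ∎
      where open ≡-Reasoning

  J-at : (S : SmallSite) → Category.AmalgamationProperty Bounded →
         GrothendieckTopology (SmallEquivalent.category S)
  J-at S ap = atomicTopology (SmallEquivalent.category S) (site-amalgamation S ap)

  record IsSubcanonicalAPClass (S : SmallSite) : Set (suc ℓ) where
    field
      coherence    : Coherence
      amalgamation : Category.AmalgamationProperty Bounded
      subcanonical : Subcanonical (SmallEquivalent.category S) (J-at S amalgamation)

    SheafTopos : Category (suc ℓ) ℓ
    SheafTopos = Sh (SmallEquivalent.category S) (J-at S amalgamation)

  -- 𝒦_λ is essentially small: every structure in it is isomorphic to one whose
  -- carrier is a subset of Λ.
  smallSite : ClassicalMetatheory ℓ → SmallSite
  smallSite meta = record
    { category = record
      { Obj       = Code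
      ; _⇒_       = λ s t → ⟦ t ⟧ ⇒ ⟦ s ⟧
      ; id        = id
      ; _∘_       = λ f g → g ∘ f
      ; identityˡ = identityʳ
      ; identityʳ = identityˡ
      ; assoc     = sym assoc
      }
    ; functor = record
      { F₀ = λ s → mkBounded ⟦ s ⟧ (bound s) ; F₁ = λ f → f ; F-id = refl ; F-∘ = λ _ _ → refl }
    ; isEquivalence = record
      { full     = λ _ _ g → g , refl
      ; faithful = λ _ _ eq → eq
      ; essSurj  = λ A → code A , iso A
      }
    }
    where
    open ClassicalMetatheory meta

    El : (Λ → Bool) → Set ℓ
    El U = Σ[ x ∈ Λ ] U x ≡ true

    El-≡ : ∀ {U} {x y : El U} → proj₁ x ≡ proj₁ y → x ≡ y
    El-≡ {x = x , _} refl = cong (x ,_) (≡-irrelevant _ _)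

    Code : Set ℓ
    Code = Σ[ U ∈ (Λ → Bool) ] proj₁ (fibreSmall (El U))

    decode : ((U , s) : Code) → Σ[ A ∈ Obj ] ∣ A ∣ ≡ El U
    decode (U , s) = Inverse.to (proj₂ (fibreSmall (El U))) s

    ⟦_⟧ : Code → Obj
    ⟦ s ⟧ = proj₁ (decode s)

    bound : (s : Code) → ∣ ⟦ s ⟧ ∣ ↣ Λ
    bound s = subst (_↣ Λ) (sym (proj₂ (decode s))) (mk↣ {to = proj₁} El-≡)

    injection : (A : BoundedStructure) → ∣ structure A ∣ ↣ Λ
    injection (mkBounded _ b) = recompute (decide _) b

    module _ (A : BoundedStructure) where
      open Injection (injection A) using (to) renaming (injective to to-injective)

      image? : ∀ x → Dec (∃[ a ] to a ≡ x)
      image? x = decide _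

      U : Λ → Bool
      U x = does (image? x)

      witness : ∀ x → U x ≡ true → ∃[ a ] to a ≡ x
      witness x = accept (image? x)
        where
        accept : {P : Set ℓ} (P? : Dec P) → does P? ≡ true → P
        accept (yes p) _ = p

      σ : ∣ structure A ∣ → El U
      σ a = to a , dec-true (image? (to a)) (a , refl)

      σ-bijective : Bijective _≡_ _≡_ σ
      σ-bijective = (λ eq → to-injective (cong proj₁ eq)) , λ (x , p) →
        proj₁ (witness x p) , λ { refl → El-≡ (proj₂ (witness x p)) }

      transported = transport (structure A) σ σ-bijective

      target : Σ[ B ∈ Obj ] ∣ B ∣ ≡ El U
      target = proj₁ transported , proj₁ (proj₂ (proj₂ (proj₂ transported)))

      code : Code
      code = U , Inverse.from (proj₂ (fibreSmall (El U))) target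

      decode-code : decode code ≡ target
      decode-code = Inverse.strictlyInverseˡ (proj₂ (fibreSmall (El U))) target

      iso : Category._≅_ (op Bounded) (mkBounded ⟦ code ⟧ (bound code)) A
      iso = let (f , g , g∘f , f∘g) = structure-iso in f , g , f∘g , g∘f
        where
        structure-iso : structure A ≅ ⟦ code ⟧
        structure-iso = subst (structure A ≅_) (sym (cong proj₁ decode-code))
          (proj₁ (proj₂ transported) , proj₁ (proj₂ (proj₂ transported)))

{-# OPTIONS --safe #-}

-- Write 𝒞 for the site 𝒦_λ^op; amalgamation says that cospans in 𝒞 complete to
-- squares, so restriction maps of sheaves are injective and constant presheaves
-- are sheaves.  Since the topos is Boolean, testing an epimorphism against the
-- constant sheaf on two points shows that it is locally surjective.
--
-- Given (1), an arrow out of a maximal structure is determined by its ends, so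
-- each sheaf F has F c ≅ F m whenever m is maximal and m ⇒ c.  Hence the topos
-- is a power of the category of sets, indexed by the components of 𝒞, and an
-- epimorphism is split by choosing preimages at one maximal object in each
-- component.
--
-- Given (2), the epimorphisms between representables split, which makes every
-- arrow of 𝒞 invertible: every structure is maximal.  A splitting of the map
-- from the representable of m onto its support is an arrow m ⇒ m that absorbs
-- all automorphisms of m, so m is rigid.

module Submission where

open import Axiom.Extensionality.Propositional using (lower-extensionality)
open import Data.Bool.Base using (Bool; true; T)
open import Data.Irrelevant using (Irrelevant; [_])
open import Data.Unit.Polymorphic.Base using (⊤)
open import Level using (Level; Lift; lift; lower; suc)
open import Data.Product using (Σ-syntax; ∃; _×_; _,_; proj₁; proj₂)
open import Function.Bundles using (_⇔_; mk⇔)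
open import Relation.Binary.PropositionalEquality
  using (_≡_; refl; sym; trans; cong; subst; module ≡-Reasoning)
open import Relation.Nullary using (Dec)
open import Relation.Nullary.Decidable
  using (recompute; isYes; isYes≗does; does-⇔; dec-true; toWitness; fromWitness)
open import Defs

private
  variable
    o h o′ h′ : Level

isYes-⇔ : ∀ {A : Set o} {B : Set h} → A ⇔ B → (a? : Dec A) (b? : Dec B) → isYes a? ≡ isYes b?
isYes-⇔ A⇔B a? b? = trans (isYes≗does a?) (trans (does-⇔ A⇔B a? b?) (sym (isYes≗does b?)))

-- Isomorphisms and their transfer along equivalences.

module Isomorphisms (𝒞 : Category o h) where
  open Category 𝒞

  inverse-isIso : ∀ {A B} {f : A ⇒ B} (i : IsIso f) → IsIso (proj₁ i)
  inverse-isIso {f = f} (_ , gf , fg) = f , fg , gf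

  cancelInner : ∀ {A B C} {f : A ⇒ B} {g : B ⇒ A} {k : A ⇒ C} →
                g ∘ f ≡ id → (k ∘ g) ∘ f ≡ k
  cancelInner {k = k} gf = trans assoc (trans (cong (k ∘_) gf) identityʳ)

  cancelOuter : ∀ {A B C} {f : A ⇒ B} {g : B ⇒ A} {k : C ⇒ A} →
                g ∘ f ≡ id → g ∘ (f ∘ k) ≡ k
  cancelOuter {k = k} gf = trans (sym assoc) (trans (cong (_∘ k) gf) identityˡ)

  ∘-isIso : ∀ {A B C} {f : A ⇒ B} {g : B ⇒ C} → IsIso f → IsIso g → IsIso (g ∘ f)
  ∘-isIso {f = f} {g} (f⁻¹ , f⁻¹f , ff⁻¹) (g⁻¹ , g⁻¹g , gg⁻¹) =
    f⁻¹ ∘ g⁻¹ ,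
    trans assoc (trans (cong (f⁻¹ ∘_) (cancelOuter g⁻¹g)) f⁻¹f) ,
    trans assoc (trans (cong (g ∘_) (cancelOuter ff⁻¹)) gg⁻¹)

  isIso-cancelʳ : ∀ {A B C} {i : A ⇒ B} {f : B ⇒ C} → IsIso i → IsIso (f ∘ i) → IsIso f
  isIso-cancelʳ i-iso@(_ , _ , ii⁻¹) fi-iso =
    subst IsIso (cancelInner ii⁻¹) (∘-isIso (inverse-isIso i-iso) fi-iso)

  isIso-cancelˡ : ∀ {A B C} {j : B ⇒ C} {f : A ⇒ B} → IsIso j → IsIso (j ∘ f) → IsIso f
  isIso-cancelˡ j-iso@(_ , j⁻¹j , _) jf-iso =
    subst IsIso (cancelOuter j⁻¹j) (∘-isIso jf-iso (inverse-isIso j-iso))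

  isIso⇒epi : ∀ {A B C} {f : A ⇒ B} {u v : B ⇒ C} → IsIso f → u ∘ f ≡ v ∘ f → u ≡ v
  isIso⇒epi (f⁻¹ , _ , ff⁻¹) eq =
    trans (sym (cancelInner ff⁻¹)) (trans (cong (_∘ f⁻¹) eq) (cancelInner ff⁻¹))

  isMaximal-≅ : ∀ {M N} → M ≅ N → IsMaximal M → IsMaximal N
  isMaximal-≅ (i , i-iso) maxM B f = isIso-cancelʳ i-iso (maxM B (f ∘ i))

op-isIso : (𝒞 : Category o h) → ∀ {A B} {f : Category._⇒_ 𝒞 A B} →
           Category.IsIso 𝒞 f → Category.IsIso (op 𝒞) f
op-isIso 𝒞 (g , gf , fg) = g , fg , gf

module Equivalences {𝒞 : Category o h} {𝒟 : Category o′ h′}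
                    (F : Functor 𝒞 𝒟) (equiv : IsEquivalence F) where
  private
    module C = Category 𝒞
    module D = Category 𝒟
  open Functor F
  open IsEquivalence equiv
  open Isomorphisms 𝒟

  reflects-isIso : ∀ {a b} (f : a C.⇒ b) → D.IsIso (F₁ f) → C.IsIso f
  reflects-isIso f (g , gf , fg) with g′ , refl ← full _ _ g =
    g′ , faithful _ _ (trans (F-∘ g′ f) (trans gf (sym F-id)))
       , faithful _ _ (trans (F-∘ f g′) (trans fg (sym F-id)))

  preserves-isIso : ∀ {a b} (f : a C.⇒ b) → C.IsIso f → D.IsIso (F₁ f)
  preserves-isIso f (g , gf , fg) =
    F₁ g , trans (sym (F-∘ g f)) (trans (cong F₁ gf) F-id)
         , trans (sym (F-∘ f g)) (trans (cong F₁ fg) F-id)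

  -- The isomorphisms given by `essSurj` at both ends conjugate `f` into the image of an arrow of
  -- `𝒞`.
  allIso : (∀ {a b} (f : a C.⇒ b) → C.IsIso f) → ∀ {A B} (f : A D.⇒ B) → D.IsIso f
  allIso iso {A} {B} f with a , i , i-iso ← essSurj A | b , j , j-iso ← essSurj B
    with g , eq ← full a b (proj₁ j-iso D.∘ (f D.∘ i)) =
    isIso-cancelʳ i-iso (isIso-cancelˡ (inverse-isIso j-iso)
      (subst D.IsIso eq (preserves-isIso g (iso g))))

  trivialEndomorphisms : (∀ {a} (f : a C.⇒ a) → f ≡ C.id) → ∀ {A} (f : A D.⇒ A) → f ≡ D.id
  trivialEndomorphisms trivial {A} f with a , i , i-iso@(i⁻¹ , i⁻¹i , ii⁻¹) ← essSurj A
    with g , eq ← full a a (i⁻¹ D.∘ (f D.∘ i)) = isIso⇒epi i-iso (begin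
      f D.∘ i                   ≡⟨ cancelOuter ii⁻¹ ⟨
      i D.∘ (i⁻¹ D.∘ (f D.∘ i)) ≡⟨ cong (i D.∘_) eq ⟨
      i D.∘ F₁ g                ≡⟨ cong (λ k → i D.∘ F₁ k) (trivial g) ⟩
      i D.∘ F₁ C.id             ≡⟨ cong (i D.∘_) F-id ⟩
      i D.∘ D.id                ≡⟨ D.identityʳ ⟩
      i                         ≡⟨ D.identityˡ ⟨
      D.id D.∘ i                ∎)
    where open ≡-Reasoning

-- Sheaves for the atomic topology.

module AtomicSite {ℓ : Level} (meta : ClassicalMetatheory ℓ) (𝒞 : Category ℓ ℓ)
                  (ore : Category.AmalgamationProperty (op 𝒞)) where
  open ClassicalMetatheory meta
  open Category 𝒞
  open Isomorphisms 𝒞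
  open ≡-Reasoning

  private
    J = atomicTopology 𝒞 ore
    module Topos = Category (Sh 𝒞 J)

  open SheafMorphism using (η)

  naturality : ∀ {F G : Sheaf 𝒞 J} (α : SheafMorphism 𝒞 J F G) {c d} (f : d ⇒ c) x →
               η α d (Sheaf.F₁ F f x) ≡ Sheaf.F₁ G f (η α c x)
  naturality (mkMorphism _ nat) f x = recompute (decide _) (nat f x)

  morphism-≡ : ∀ {F G : Sheaf 𝒞 J} {α β : SheafMorphism 𝒞 J F G} →
               (∀ c x → η α c x ≡ η β c x) → α ≡ β
  morphism-≡ {α = mkMorphism _ _} {mkMorphism _ _} eq = same (ext λ c → ext (eq c))
    where
    ext : ∀ {A : Set ℓ} {B : A → Set ℓ} {f g : ∀ x → B x} → (∀ x → f x ≡ g x) → f ≡ g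
    ext = lower-extensionality (suc ℓ) (suc ℓ) funext

    same : ∀ {F G : Sheaf 𝒞 J} {α β : ∀ c → Sheaf.F₀ F c → Sheaf.F₀ G c}
           .{p : ∀ {c d} (f : d ⇒ c) x → α d (Sheaf.F₁ F f x) ≡ Sheaf.F₁ G f (α c x)}
           .{q : ∀ {c d} (f : d ⇒ c) x → β d (Sheaf.F₁ F f x) ≡ Sheaf.F₁ G f (β c x)} →
           α ≡ β → _≡_ {A = SheafMorphism 𝒞 J F G} (mkMorphism α p) (mkMorphism β q)
    same refl = refl

  principal : ∀ {c d} → d ⇒ c → Sieve 𝒞 c
  principal {d = d} k = generated 𝒞 {I = ⊤} (λ _ → d) (λ _ → k)

  module _ (F : Sheaf 𝒞 J) where
    open Sheaf F

    -- Both `x` and `y` amalgamate the restrictions of `x` to the sieve generated by `k`, which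
    -- covers because it contains `k`.
    restriction-injective : ∀ {c d} (k : d ⇒ c) {x y : F₀ c} → F₁ k x ≡ F₁ k y → x ≡ y
    restriction-injective {c} {d} k {x} {y} eq =
      trans (sym (unique λ _ _ → refl)) (unique amalgamates-y)
      where
      family : MatchingFamily 𝒞 presheaf (principal k)
      family = record { section = λ f _ → F₁ f x ; matching = λ f _ g _ → sym (F-∘ g f x) }

      unique : ∀ {z} → IsAmalgamation 𝒞 presheaf family z →
               proj₁ (isSheaf (principal k) (d , k , _ , id , identityʳ) family) ≡ z
      unique = proj₂ (proj₂ (isSheaf (principal k) (d , k , _ , id , identityʳ) family))

      amalgamates-y : IsAmalgamation 𝒞 presheaf family y
      amalgamates-y f (_ , j , refl) = begin
        F₁ (k ∘ j) y    ≡⟨ F-∘ j k y ⟩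
        F₁ j (F₁ k y)   ≡⟨ cong (F₁ j) eq ⟨
        F₁ j (F₁ k x)   ≡⟨ F-∘ j k x ⟨
        F₁ (k ∘ j) x    ∎

  -- Two arrows of a covering sieve complete to a square, so a matching family of constants has a
  -- single value.
  constant : Set ℓ → Sheaf 𝒞 J
  constant A = record { presheaf = presheaf ; isSheaf = isSheaf }
    where
    presheaf : Presheaf 𝒞
    presheaf = record
      { F₀ = λ _ → A ; F₁ = λ _ x → x ; F-id = λ _ → refl ; F-∘ = λ _ _ _ → refl }

    isSheaf : IsSheaf 𝒞 J presheaf
    isSheaf {c} S (d , f , p) x =
      section f p , (λ g q → section-const g f q p) , λ am → sym (am f p)
      where
      open MatchingFamily x

      section-subst : ∀ {e} {g g′ : e ⇒ c} (eq : g ≡ g′) r →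
                      section g (subst (arrows S) (sym eq) r) ≡ section g′ r
      section-subst refl _ = refl

      section-const : ∀ {d e} (f : d ⇒ c) (g : e ⇒ c) p q → section g q ≡ section f p
      section-const f g p q with _ , k , l , eq ← ore _ _ _ f g = begin
        section g q                       ≡⟨ matching g q l _ ⟩
        section (g ∘ l) (closed S l q)    ≡⟨ section-subst eq _ ⟨
        section (f ∘ k) _                 ≡⟨ matching f p k _ ⟨
        section f p                       ∎

  -- Epimorphisms and local surjectivity.

  module _ {X I : Sheaf 𝒞 J} (f : SheafMorphism 𝒞 J X I) where
    private
      module X = Sheaf X
      module I = Sheaf I

    -- Membership of `y` in the image subsheaf of `f`.
    LocallyHit : ∀ {c} → I.F₀ c → Set ℓ
    LocallyHit {c} y = Σ[ d ∈ Obj ] Σ[ g ∈ d ⇒ c ] Σ[ x ∈ X.F₀ d ] η f d x ≡ I.F₁ g y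

    -- Invariance in both directions makes the complement of the image stable under restriction too,
    -- as the naturality of `isHit` requires.
    locallyHit-restrict : ∀ {c d} (k : d ⇒ c) (y : I.F₀ c) →
                          LocallyHit (I.F₁ k y) ⇔ LocallyHit y
    locallyHit-restrict k y = mk⇔
      (λ (e , g , x , eq) → e , k ∘ g , x , trans eq (sym (I.F-∘ g k y)))
      λ (e , g , x , eq) → let (a , u , v , sq) = ore _ _ _ g k in
        a , v , X.F₁ u x , (begin
          η f a (X.F₁ u x)     ≡⟨ naturality f u x ⟩
          I.F₁ u (η f e x)     ≡⟨ cong (I.F₁ u) eq ⟩
          I.F₁ u (I.F₁ g y)    ≡⟨ I.F-∘ u g y ⟨
          I.F₁ (g ∘ u) y       ≡⟨ cong (λ w → I.F₁ w y) sq ⟩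
          I.F₁ (k ∘ v) y       ≡⟨ I.F-∘ v k y ⟩
          I.F₁ v (I.F₁ k y)    ∎)

    -- The characteristic map of the image and the constant map at `true` agree after `f`, hence
    -- everywhere.
    epi⇒locallySurjective : Topos.IsEpi {X} {I} f → ∀ {c} (y : I.F₀ c) → LocallyHit y
    epi⇒locallySurjective epi {c} y = toWitness {a? = decide (LocallyHit y)}
      (subst T (cong (λ α → lower (η α c y)) (sym equal)) _)
      where
      𝟚 = constant (Lift ℓ Bool)

      isHit everything : SheafMorphism 𝒞 J I 𝟚
      isHit = mkMorphism (λ _ z → lift (isYes (decide (LocallyHit z))))
        λ k z → cong lift (isYes-⇔ (locallyHit-restrict k z) (decide _) (decide _))
      everything = mkMorphism (λ _ _ → lift true) λ _ _ → refl

      hit : ∀ c x → η isHit c (η f c x) ≡ lift true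
      hit c x = cong lift (trans (isYes≗does (decide _))
        (dec-true (decide _) (c , id , x , sym (I.F-id _))))

      equal : isHit ≡ everything
      equal = epi {𝟚} isHit everything (morphism-≡ {X} {𝟚} hit)

    -- Maps that agree after `f` agree on some restriction of each `y`, and restrictions in `Z` are
    -- injective.
    surjective⇒epi : (∀ {c} (y : I.F₀ c) → LocallyHit y) → Topos.IsEpi {X} {I} f
    surjective⇒epi hit {Z} u v eq = morphism-≡ {I} {Z} λ c y →
      let (d , g , x , fx≡gy) = hit y in
      restriction-injective Z g (begin
        Sheaf.F₁ Z g (η u c y)  ≡⟨ naturality u g y ⟨
        η u d (I.F₁ g y)        ≡⟨ cong (η u d) fx≡gy ⟨
        η u d (η f d x)         ≡⟨ cong (λ α → η α d x) eq ⟩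
        η v d (η f d x)         ≡⟨ cong (η v d) fx≡gy ⟩
        η v d (I.F₁ g y)        ≡⟨ naturality v g y ⟩
        Sheaf.F₁ Z g (η v c y)  ∎)

  -- Objects that are maximal and rigid in the opposite category.

  IsRigidMaximal : Obj → Set ℓ
  IsRigidMaximal m = Category.IsMaximal (op 𝒞) m × Category.IsRigid (op 𝒞) m

  module RigidMaximal {m} (m-rigidMaximal : IsRigidMaximal m) where
    private
      maximal = proj₁ m-rigidMaximal
      rigid   = proj₂ m-rigidMaximal

    isIso : ∀ {d} (f : d ⇒ m) → IsIso f
    isIso f = op-isIso (op 𝒞) (maximal _ f)

    -- Completed to a square, `f` and `g` differ by `l ∘ k⁻¹`, an automorphism of `m` by maximality
    -- and so the identity by rigidity.
    arrow-unique : ∀ {c} (f g : m ⇒ c) → f ≡ g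
    arrow-unique f g with _ , k , l , fk≡gl ← ore _ _ _ f g
      with k⁻¹ , k⁻¹k , kk⁻¹ ← isIso k = begin
      f                ≡⟨ cancelInner kk⁻¹ ⟨
      (f ∘ k) ∘ k⁻¹    ≡⟨ cong (_∘ k⁻¹) fk≡gl ⟩
      (g ∘ l) ∘ k⁻¹    ≡⟨ assoc ⟩
      g ∘ (l ∘ k⁻¹)    ≡⟨ cong (g ∘_) (rigid (l ∘ k⁻¹) (maximal _ _)) ⟩
      g ∘ id           ≡⟨ identityʳ ⟩
      g                ∎

    lifts-unique : ∀ {c d} (k : d ⇒ m) (f g : d ⇒ c) → f ≡ g
    lifts-unique k f g = isIso⇒epi (inverse-isIso (isIso k)) (arrow-unique _ _)

    arrow-descends : ∀ {c d} → d ⇒ c → m ⇒ c → m ⇒ d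
    arrow-descends k f with _ , u , v , _ ← ore _ _ _ f k = v ∘ proj₁ (isIso u)

    -- By `lifts-unique` an arrow in the sieve generated by `e` factors through `m` in one way only,
    -- so restricting `x` along the factor gives a matching family.
    restriction-surjective : ∀ (F : Sheaf 𝒞 J) {c} (e : m ⇒ c) (x : Sheaf.F₀ F m) →
                             Σ[ z ∈ Sheaf.F₀ F c ] Sheaf.F₁ F e z ≡ x
    restriction-surjective F e x =
      let (z , am , _) = isSheaf (principal e) (m , e , _ , id , identityʳ) family in
      z , trans (am e (_ , id , identityʳ)) (F-id x)
      where
      open Sheaf F

      family : MatchingFamily 𝒞 presheaf (principal e)
      family = record
        { section  = λ _ (_ , k , _) → F₁ k x
        ; matching = λ _ (_ , k , _) g (_ , l , _) →
            trans (sym (F-∘ g k x)) (cong (λ u → F₁ u x) (lifts-unique l _ _))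
        }

    locallyHit⇒hit : ∀ {X I : Sheaf 𝒞 J} (f : SheafMorphism 𝒞 J X I) (y : Sheaf.F₀ I m) →
                     LocallyHit {X} {I} f y → Σ[ x ∈ Sheaf.F₀ X m ] η f m x ≡ y
    locallyHit⇒hit {X} {I} f y (d , g , x , eq) with g⁻¹ , _ , gg⁻¹ ← isIso g =
      X.F₁ g⁻¹ x , (begin
        η f m (X.F₁ g⁻¹ x)     ≡⟨ naturality f g⁻¹ x ⟩
        I.F₁ g⁻¹ (η f d x)     ≡⟨ cong (I.F₁ g⁻¹) eq ⟩
        I.F₁ g⁻¹ (I.F₁ g y)    ≡⟨ I.F-∘ g⁻¹ g y ⟨
        I.F₁ (g ∘ g⁻¹) y       ≡⟨ cong (λ w → I.F₁ w y) gg⁻¹ ⟩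
        I.F₁ id y              ≡⟨ I.F-id y ⟩
        y                      ∎)
      where
      module X = Sheaf X
      module I = Sheaf I

  -- Splitting epimorphisms at rigid maximal objects.

  module Choice (enough : ∀ c → Σ[ m ∈ Obj ] (IsRigidMaximal m × (m ⇒ c))) where

    Over : Obj → Obj → Set ℓ
    Over c m = IsRigidMaximal m × (m ⇒ c)

    -- Boolean values turn logical equivalence into equality by function extensionality, as
    -- `pick-cong` needs.
    over : Obj → Obj → Bool
    over c m = isYes (decide (Over c m))

    over-cong : ∀ {c d} → d ⇒ c → over d ≡ over c
    over-cong k = lower-extensionality (suc ℓ) (suc ℓ) funext λ m → isYes-⇔
      (mk⇔ (λ (a , f) → a , k ∘ f) (λ (a , f) → a , RigidMaximal.arrow-descends a k f))
      (decide _) (decide _)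

    -- The element chosen depends on the Boolean predicate alone, so objects in
    -- the same component get the same root.
    pick : (P : Obj → Bool) → .(∃ λ m → T (P m)) → ∃ λ m → T (P m)
    pick P inhabited = recompute (decide _) inhabited

    pick-cong : ∀ {P Q} .(p : ∃ λ m → T (P m)) .(q : ∃ λ m → T (Q m)) →
                P ≡ Q → proj₁ (pick P p) ≡ proj₁ (pick Q q)
    pick-cong p q refl = refl

    inhabited : ∀ c → ∃ λ m → T (over c m)
    inhabited c = let (m , w) = enough c in m , fromWitness w

    root : Obj → Obj
    root c = proj₁ (pick (over c) (inhabited c))

    root-over : ∀ c → Over c (root c)
    root-over c = toWitness (proj₂ (pick (over c) (inhabited c)))

    root-cong : ∀ {c d} → d ⇒ c → root d ≡ root c
    root-cong k = pick-cong (inhabited _) (inhabited _) (over-cong k)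

    externalChoice : Topos.ExternalChoice
    externalChoice {X} {I} f epi = mkMorphism s s-natural , morphism-≡ {I} {I} fs≡id
      where
      module X = Sheaf X
      module I = Sheaf I

      -- Irrelevance makes the chosen preimage depend on `m` and `y` only, so different proofs of
      -- rigid maximality yield the same one.
      preimage : ∀ {m} → .(IsRigidMaximal m) → (y : I.F₀ m) → Σ[ x ∈ X.F₀ m ] η f m x ≡ y
      preimage a y = recompute (decide _)
        (RigidMaximal.locallyHit⇒hit a {X} {I} f y (epi⇒locallySurjective {X} {I} f epi y))

      extension : ∀ c (y : I.F₀ c) (((a , e)) : Over c (root c)) →
                  Σ[ z ∈ X.F₀ c ] X.F₁ e z ≡ proj₁ (preimage a (I.F₁ e y))
      extension c y (a , e) = RigidMaximal.restriction-surjective a X e _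

      s : ∀ c → I.F₀ c → X.F₀ c
      s c y = proj₁ (extension c y (root-over c))

      -- The value of `s` is built from one arrow out of the root; uniqueness of arrows extends its
      -- equation to every `e`, in particular to `k ∘ e` in `s-natural`.
      s-spec : ∀ {c m} (y : I.F₀ c) (a : IsRigidMaximal m) (e : m ⇒ c) → m ≡ root c →
               X.F₁ e (s c y) ≡ proj₁ (preimage a (I.F₁ e y))
      s-spec {c} y a e refl =
        subst (λ e → X.F₁ e (s c y) ≡ proj₁ (preimage a (I.F₁ e y)))
          (RigidMaximal.arrow-unique a _ e) (proj₂ (extension c y (root-over c)))

      s-natural : ∀ {c d} (k : d ⇒ c) (y : I.F₀ c) → s d (I.F₁ k y) ≡ X.F₁ k (s c y)
      s-natural {c} {d} k y = let (a , e) = root-over d in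
        restriction-injective X e (begin
          X.F₁ e (s d (I.F₁ k y))                ≡⟨ s-spec (I.F₁ k y) a e refl ⟩
          proj₁ (preimage a (I.F₁ e (I.F₁ k y))) ≡⟨ cong (λ z → proj₁ (preimage a z)) (I.F-∘ e k y) ⟨
          proj₁ (preimage a (I.F₁ (k ∘ e) y))    ≡⟨ s-spec y a (k ∘ e) (root-cong k) ⟨
          X.F₁ (k ∘ e) (s c y)                   ≡⟨ X.F-∘ e k (s c y) ⟩
          X.F₁ e (X.F₁ k (s c y))                ∎)

      fs≡id : ∀ c y → η f c (s c y) ≡ y
      fs≡id c y = let (a , e) = root-over c in
        restriction-injective I e (begin
          I.F₁ e (η f c (s c y))                   ≡⟨ naturality f e (s c y) ⟨
          η f (root c) (X.F₁ e (s c y))            ≡⟨ cong (η f (root c)) (s-spec y a e refl) ⟩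
          η f (root c) (proj₁ (preimage a (I.F₁ e y))) ≡⟨ proj₂ (preimage a (I.F₁ e y)) ⟩
          I.F₁ e y                                 ∎)

  -- Invertibility and rigidity from external choice.

  module SplitEpis (epic : ∀ {a b c} (f : a ⇒ b) (u v : b ⇒ c) → u ∘ f ≡ v ∘ f → u ≡ v)
                   (subcanonical : Subcanonical 𝒞 J)
                   (choice : Topos.ExternalChoice) where

    y : Obj → Sheaf 𝒞 J
    y c = record { presheaf = representable 𝒞 c ; isSheaf = subcanonical c }

    -- Composition with `f` is locally surjective on representables by `ore`. A splitting evaluated
    -- at `id` is a right inverse `s` of `f`, and cancelling the epimorphism `s` makes it a left
    -- inverse.
    isIso : ∀ {d c} (f : d ⇒ c) → IsIso f
    isIso {d} {c} f = s , epic s _ _ sfs≡s , fs≡id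
      where
      yf : SheafMorphism 𝒞 J (y d) (y c)
      yf = mkMorphism (λ _ g → f ∘ g) λ _ _ → sym assoc

      splitting = choice {y d} {y c} yf (surjective⇒epi {y d} {y c} yf λ u →
        let (a , k , l , eq) = ore _ _ _ f u in a , l , k , eq)

      s : c ⇒ d
      s = η (proj₁ splitting) c id

      fs≡id : f ∘ s ≡ id
      fs≡id = cong (λ α → η α c id) (proj₂ splitting)

      sfs≡s : (s ∘ f) ∘ s ≡ id ∘ s
      sfs≡s = trans (cancelInner fs≡id) (sym identityˡ)

    -- The image of the representable of `m` in the terminal sheaf: irrelevance retains only that an
    -- arrow to `m` exists.
    support : Obj → Sheaf 𝒞 J
    support m = record
      { presheaf = record
        { F₀   = λ c → Irrelevant (c ⇒ m)
        ; F₁   = λ k ([ f ]) → [ f ∘ k ]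
        ; F-id = λ _ → refl
        ; F-∘  = λ _ _ _ → refl
        }
      ; isSheaf = λ S (d , f , p) x →
          descend f (MatchingFamily.section x f p) , (λ _ _ → refl) , λ _ → refl
      }
      where
      descend : ∀ {c d} → d ⇒ c → Irrelevant (d ⇒ m) → Irrelevant (c ⇒ m)
      descend f ([ g ]) = [ g ∘ proj₁ (isIso f) ]

    rigid : ∀ {m} (σ : m ⇒ m) → σ ≡ id
    rigid {m} σ = isMono (begin
      -- Restricting `[ id ]` along `σ` gives the same element of the support, so naturality reads
      -- `φ ≡ φ ∘ σ`.
      φ ∘ σ     ≡⟨ naturality (proj₁ splitting) σ [ id ] ⟨
      φ         ≡⟨ identityʳ ⟨
      φ ∘ id    ∎)
      where
      quotient : SheafMorphism 𝒞 J (y m) (support m)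
      quotient = mkMorphism (λ _ f → [ f ]) λ _ _ → refl

      hit : ∀ {c} (z : Irrelevant (c ⇒ m)) → LocallyHit {y m} {support m} quotient z
      -- The recomputed arrow may differ from `f`, but both have the same image in the support.
      hit {c} ([ f ]) = c , id , recompute (decide (c ⇒ m)) f , refl

      splitting = choice {y m} {support m} quotient
        (surjective⇒epi {y m} {support m} quotient hit)

      φ : m ⇒ m
      φ = η (proj₁ splitting) m [ id ]

      isMono : ∀ {u v : m ⇒ m} → φ ∘ u ≡ φ ∘ v → u ≡ v
      isMono eq = let (φ⁻¹ , φ⁻¹φ , _) = isIso φ in
        trans (sym (cancelOuter φ⁻¹φ)) (trans (cong (φ⁻¹ ∘_) eq) (cancelOuter φ⁻¹φ))

-- Transfer between the site and the structure-class.

theorem6p19 : ∀ {ℓ : Level} → ClassicalMetatheory ℓ →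
    (Λ : Set ℓ) → InfiniteCardinal Λ →
    (𝒦 : StructureClass ℓ) →
    (S : SmallSite 𝒦 Λ) →
    (apClass : IsSubcanonicalAPClass 𝒦 Λ S) →
    (Category.MaximalExtensionProperty (Bounded 𝒦 Λ)
    × (∀ M → Category.IsMaximal (Bounded 𝒦 Λ) M → StructureClass.IsRigid 𝒦 (structure M)))
    ⇔ Category.ExternalChoice (IsSubcanonicalAPClass.SheafTopos apClass)
theorem6p19 meta Λ _ 𝒦 S apClass = mk⇔
  (λ (extend , rigid) {X} {I} → Choice.externalChoice (enough extend rigid) {X} {I})
  λ choice → maximalExtension (λ {X} {I} → choice {X} {I}) ,
    λ M _ σ _ → trivial (λ {X} {I} → choice {X} {I}) {M} σ
  where
  open IsSubcanonicalAPClass apClass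
  open StructureClass 𝒦 using (_∘_; ∣_∣₁; ∣∘∣; injective; faithful)
  𝒞 = SmallEquivalent.category S
  𝒟 = op (Bounded 𝒦 Λ)
  module B = Category (Bounded 𝒦 Λ)
  module C = Category 𝒞
  open Functor (SmallEquivalent.functor S)
  open IsEquivalence (SmallEquivalent.isEquivalence S)
    using (full; essSurj) renaming (faithful to F-faithful)
  open Equivalences (SmallEquivalent.functor S) (SmallEquivalent.isEquivalence S)
  open AtomicSite meta 𝒞 (site-amalgamation 𝒦 Λ S amalgamation)

  -- A maximal extension of `F₀ c` is replaced by an isomorphic `F₀ m`, whose properties the
  -- equivalence reflects to `m`.
  enough : B.MaximalExtensionProperty →
           (∀ M → B.IsMaximal M → StructureClass.IsRigid 𝒦 (structure M)) →
           ∀ c → Σ[ m ∈ C.Obj ] (IsRigidMaximal m × (m C.⇒ c))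
  enough extend rigid c with M , maxM , f ← extend (F₀ c)
    with m , i , i-iso ← essSurj M =
      m , (max-m , rigid-m) , proj₁ (full m c (i ∘ f))
    where
    max-Fm : B.IsMaximal (F₀ m)
    max-Fm = Isomorphisms.isMaximal-≅ (Bounded 𝒦 Λ) {M} {F₀ m}
      (i , op-isIso 𝒟 {F₀ m} {M} i-iso) maxM

    max-m : Category.IsMaximal (op 𝒞) m
    max-m d g = op-isIso 𝒞 (reflects-isIso g
      (op-isIso (Bounded 𝒦 Λ) {F₀ m} {F₀ d} (max-Fm (F₀ d) (F₁ g))))

    rigid-m : Category.IsRigid (op 𝒞) m
    rigid-m g _ = F-faithful _ _
      (trans (rigid (F₀ m) max-Fm (F₁ g) (max-Fm (F₀ m) (F₁ g))) (sym F-id))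

  -- Embeddings are injective on carriers, hence monic, and the site reverses arrows.
  epic : ∀ {a b c} (f : a C.⇒ b) (u v : b C.⇒ c) → u C.∘ f ≡ v C.∘ f → u ≡ v
  epic f u v eq = F-faithful _ _ (faithful λ x → injective (F₁ f) (begin
    ∣ F₁ f ∣₁ (∣ F₁ u ∣₁ x)  ≡⟨ ∣∘∣ (F₁ f) (F₁ u) x ⟨
    ∣ F₁ f ∘ F₁ u ∣₁ x       ≡⟨ cong (λ w → ∣ w ∣₁ x) (F-∘ u f) ⟨
    ∣ F₁ (u C.∘ f) ∣₁ x      ≡⟨ cong (λ w → ∣ F₁ w ∣₁ x) eq ⟩
    ∣ F₁ (v C.∘ f) ∣₁ x      ≡⟨ cong (λ w → ∣ w ∣₁ x) (F-∘ v f) ⟩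
    ∣ F₁ f ∘ F₁ v ∣₁ x       ≡⟨ ∣∘∣ (F₁ f) (F₁ v) x ⟩
    ∣ F₁ f ∣₁ (∣ F₁ v ∣₁ x)  ∎))
    where open ≡-Reasoning

  module _ (choice : Category.ExternalChoice SheafTopos) where
    open SplitEpis epic subcanonical choice

    maximalExtension : B.MaximalExtensionProperty
    -- Every embedding is invertible, so `A` is itself maximal.
    maximalExtension A = A , (λ B f → op-isIso 𝒟 {B} {A} (allIso isIso {B} {A} f)) , B.id {A}

    trivial : ∀ {M} (σ : M B.⇒ M) → σ ≡ B.id {M}
    trivial {M} σ = trivialEndomorphisms rigid {M} σ
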